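{- Let $F$ be a one-dimensional tropical fan in $\mathbb{R}^n$ whose rays span $\mathbb{R}^n$, with primitive generators $v_1,\dots,v_q$ and weights $\omega_1,\dots,\omega_q$. Let $l\in(\mathbb{Z}^n)^\vee$ and let $L=\max(0,l)$ be such that $L\cdot F=1$. Then $g(F,L)$ is a set of two rays $\{\mathbb{R}_+v_a,\mathbb{R}_+v_b\}$ such that: - $l(v_a)=1$, $l(v_b)=-1$ and $\omega_a=\omega_b=1$; - $l(v_i)=0$ for all $i\ne a,b$.
   Context: A one-dimensional tropical fan $F$ in $\mathbb{R}^n$ consists of finitely many distinct rays $\mathbb{R}_+v_1,\dots,\mathbb{R}_+v_q$ (and the origin), with $v_i\in\mathbb{Z}^n$ primitive, together with positive integer weights $\omega_1,\dots,\omega_q$ satisfying the balancing condition $\sum_i\omega_iv_i=0$. For $L=\max(0,l)$ with $l\in(\mathbb{Z}^n)^\vee$, the intersection number is $L\cdot F=\sum_{i=1}^q\omega_iL(v_i)$. If $L\cdot F=1$, the gallery of $F$ over $L$ is the set of rays $g(F,L)=\{\mathbb{R}_+v_i: L(v_i)+L(-v_i)=1\}$ (i.e. the rays whose spanned line, with weight $1$, has intersection number $1$ with $L$). -}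

module Defs where

open import Algebra.Module.Bundles.Raw using (RawLeftModule)
open import Algebra.Module.Morphism.Structures using (module LeftModuleMorphisms)
open import Data.Fin.Base using (Fin)
open import Data.Integer.Base as ℤ using (ℤ; 0ℤ; 1ℤ)
open import Data.Nat.Base as ℕ using (ℕ)
import Data.Nat.Properties as ℕₚ
open import Data.Product.Base using (Σ-syntax; ∃-syntax; _×_; _,_)
open import Data.Rational.Base as ℚ using (ℚ; 0ℚ; 1ℚ; ½)
import Data.Rational.Properties as ℚₚ
open import Data.Rational.Solver using (module +-*-Solver)
open import Data.Sum.Base using (_⊎_)
open import Data.Vec.Functional using (Vector; foldr)
open import Function.Base using (_∘_)
open import Function.Definitions using (Injective)
open import Level using (0ℓ)
open import Relation.Binary.PropositionalEquality using (_≡_; _≗_; refl; sym; trans; cong; subst)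
open import Relation.Unary using (Pred; _≐_)

-- Real numbers as Cauchy sequences of rationals, with equality _≃_.
-- Only addition and multiplication by integers are needed, since
-- all generators of rays are integral.

record ℝ : Set where
  constructor mkℝ
  field
    seq    : ℕ → ℚ
    cauchy : ∀ ε → 0ℚ ℚ.< ε →
             ∃[ N ] (∀ m n → N ℕ.≤ m → N ℕ.≤ n → ℚ.∣ seq m ℚ.- seq n ∣ ℚ.< ε)

open ℝ public

infix 4 _≃_

_≃_ : ℝ → ℝ → Set
x ≃ y = ∀ ε → 0ℚ ℚ.< ε → ∃[ N ] (∀ m → N ℕ.≤ m → ℚ.∣ seq x m ℚ.- seq y m ∣ ℚ.< ε)

0≤ℝ_ : ℝ → Set
0≤ℝ x = ∀ ε → 0ℚ ℚ.< ε → ∃[ N ] (∀ m → N ℕ.≤ m → ℚ.- ε ℚ.< seq x m)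

0ℝ : ℝ
0ℝ = mkℝ (λ _ → 0ℚ) (λ ε 0<ε → 0 , λ _ _ _ _ → 0<ε)

infixl 6 _+ℝ_

_+ℝ_ : ℝ → ℝ → ℝ
x +ℝ y = mkℝ (λ n → seq x n ℚ.+ seq y n) cau
  where
  open +-*-Solver
  regroup : ∀ a b c d → (a ℚ.+ b) ℚ.- (c ℚ.+ d) ≡ (a ℚ.- c) ℚ.+ (b ℚ.- d)
  regroup = solve 4 (λ a b c d → (a :+ b) :- (c :+ d) := (a :- c) :+ (b :- d)) refl

  halves : ∀ ε → ½ ℚ.* ε ℚ.+ ½ ℚ.* ε ≡ ε
  halves ε = trans (sym (ℚₚ.*-distribʳ-+ ε ½ ½)) (ℚₚ.*-identityˡ ε)

  cau : ∀ ε → 0ℚ ℚ.< ε → ∃[ N ] (∀ m n → N ℕ.≤ m → N ℕ.≤ n →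
        ℚ.∣ (seq x m ℚ.+ seq y m) ℚ.- (seq x n ℚ.+ seq y n) ∣ ℚ.< ε)
  cau ε 0<ε with cauchy x (½ ℚ.* ε) 0<ε/2 | cauchy y (½ ℚ.* ε) 0<ε/2
    where
    0<ε/2 : 0ℚ ℚ.< ½ ℚ.* ε
    0<ε/2 = ℚₚ.positive⁻¹ (½ ℚ.* ε) {{ℚₚ.pos*pos⇒pos ½ ε {{ℚ.positive 0<ε}}}}
  ... | M , p | N , q = M ℕ.⊔ N , λ m n M⊔N≤m M⊔N≤n →
    subst (ℚ.∣ (seq x m ℚ.+ seq y m) ℚ.- (seq x n ℚ.+ seq y n) ∣ ℚ.<_) (halves ε)
      (subst (λ z → ℚ.∣ z ∣ ℚ.< ½ ℚ.* ε ℚ.+ ½ ℚ.* ε)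
        (sym (regroup (seq x m) (seq y m) (seq x n) (seq y n)))
        (ℚₚ.≤-<-trans (ℚₚ.∣p+q∣≤∣p∣+∣q∣ (seq x m ℚ.- seq x n) (seq y m ℚ.- seq y n))
          (ℚₚ.+-mono-<
            (p m n (ℕₚ.≤-trans (ℕₚ.m≤m⊔n M N) M⊔N≤m) (ℕₚ.≤-trans (ℕₚ.m≤m⊔n M N) M⊔N≤n))
            (q m n (ℕₚ.≤-trans (ℕₚ.m≤n⊔m M N) M⊔N≤m) (ℕₚ.≤-trans (ℕₚ.m≤n⊔m M N) M⊔N≤n)))))

infixl 7 _*ℤ_

_*ℤ_ : ℝ → ℤ → ℝ
x *ℤ k = mkℝ (λ n → seq x n ℚ.* κ) cau
  where
  κ c : ℚ
  κ = k ℚ./ 1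
  c = 1ℚ ℚ.+ ℚ.∣ κ ∣

  instance
    ∣κ∣≥0 : ℚ.NonNegative ℚ.∣ κ ∣
    ∣κ∣≥0 = ℚ.nonNegative (ℚₚ.0≤∣p∣ κ)
    c>0 : ℚ.Positive c
    c>0 = ℚₚ.pos+nonNeg⇒pos 1ℚ ℚ.∣ κ ∣
    c≢0 : ℚ.NonZero c
    c≢0 = ℚₚ.pos⇒nonZero c
    1/c>0 : ℚ.Positive (ℚ.1/ c)
    1/c>0 = ℚₚ.1/pos⇒pos c

  open +-*-Solver
  factor : ∀ a b d → a ℚ.* d ℚ.- b ℚ.* d ≡ (a ℚ.- b) ℚ.* d
  factor = solve 3 (λ a b d → a :* d :- b :* d := (a :- b) :* d) refl

  ∣κ∣≤c : ℚ.∣ κ ∣ ℚ.≤ c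
  ∣κ∣≤c = subst (ℚ._≤ c) (ℚₚ.+-identityˡ ℚ.∣ κ ∣)
            (ℚₚ.+-monoˡ-≤ ℚ.∣ κ ∣ (ℚₚ.nonNegative⁻¹ 1ℚ))

  cau : ∀ ε → 0ℚ ℚ.< ε → ∃[ N ] (∀ m n → N ℕ.≤ m → N ℕ.≤ n →
        ℚ.∣ seq x m ℚ.* κ ℚ.- seq x n ℚ.* κ ∣ ℚ.< ε)
  cau ε 0<ε with cauchy x (ε ℚ.* ℚ.1/ c)
                   (ℚₚ.positive⁻¹ (ε ℚ.* ℚ.1/ c)
                     {{ℚₚ.pos*pos⇒pos ε {{ℚ.positive 0<ε}} (ℚ.1/ c)}})
  ... | N , p = N , λ m n N≤m N≤n → begin-strict
    ℚ.∣ seq x m ℚ.* κ ℚ.- seq x n ℚ.* κ ∣    ≡⟨ cong ℚ.∣_∣ (factor (seq x m) (seq x n) κ) ⟩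
    ℚ.∣ (seq x m ℚ.- seq x n) ℚ.* κ ∣        ≡⟨ ℚₚ.∣p*q∣≡∣p∣*∣q∣ (seq x m ℚ.- seq x n) κ ⟩
    ℚ.∣ seq x m ℚ.- seq x n ∣ ℚ.* ℚ.∣ κ ∣    ≤⟨ ℚₚ.*-monoˡ-≤-nonNeg ℚ.∣ seq x m ℚ.- seq x n ∣
                                                  {{ℚ.nonNegative (ℚₚ.0≤∣p∣ (seq x m ℚ.- seq x n))}} ∣κ∣≤c ⟩
    ℚ.∣ seq x m ℚ.- seq x n ∣ ℚ.* c          <⟨ ℚₚ.*-monoˡ-<-pos c (p m n N≤m N≤n) ⟩
    ε ℚ.* ℚ.1/ c ℚ.* c                       ≡⟨ ℚₚ.*-assoc ε (ℚ.1/ c) c ⟩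
    ε ℚ.* (ℚ.1/ c ℚ.* c)                     ≡⟨ cong (ε ℚ.*_) (ℚₚ.*-inverseˡ c) ⟩
    ε ℚ.* 1ℚ                                 ≡⟨ ℚₚ.*-identityʳ ε ⟩
    ε                                        ∎
    where open ℚₚ.≤-Reasoning

sumℝ : ∀ {q} → Vector ℝ q → ℝ
sumℝ = foldr _+ℝ_ 0ℝ

sumℤ : ∀ {q} → Vector ℤ q → ℤ
sumℤ = foldr ℤ._+_ 0ℤ

ℝ^ ℤ^ : ℕ → Set
ℝ^ n = Vector ℝ n
ℤ^ n = Vector ℤ n

infix 8 -ᵛ_

-ᵛ_ : ∀ {n} → ℤ^ n → ℤ^ n
(-ᵛ x) j = ℤ.- x j

ℤ^-rawModule : ℕ → RawLeftModule ℤ 0ℓ 0ℓ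
ℤ^-rawModule n = record
  { Carrierᴹ = ℤ^ n
  ; _≈ᴹ_     = _≗_
  ; _+ᴹ_     = λ x y j → x j ℤ.+ y j
  ; _*ₗ_     = λ k x j → k ℤ.* x j
  ; 0ᴹ       = λ _ → 0ℤ
  ; -ᴹ_      = -ᵛ_
  }

ℤ-rawModule : RawLeftModule ℤ 0ℓ 0ℓ
ℤ-rawModule = record
  { Carrierᴹ = ℤ
  ; _≈ᴹ_     = _≡_
  ; _+ᴹ_     = ℤ._+_
  ; _*ₗ_     = ℤ._*_
  ; 0ᴹ       = 0ℤ
  ; -ᴹ_      = ℤ.-_
  }

record Dual (n : ℕ) : Set where
  open LeftModuleMorphisms (ℤ^-rawModule n) ℤ-rawModule
  field
    ⟦_⟧      : ℤ^ n → ℤ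
    isLinear : IsLeftModuleHomomorphism ⟦_⟧

open Dual public

-- The restriction of max(0,l) to ℤⁿ, the only points where it is evaluated.
max0 : ∀ {n} → Dual n → ℤ^ n → ℤ
max0 l x = 0ℤ ℤ.⊔ ⟦ l ⟧ x

-- The zero vector is excluded, being 2 times itself.
Primitive : ∀ {n} → ℤ^ n → Set
Primitive {n} v = ∀ (k : ℤ) (w : ℤ^ n) → (∀ j → v j ≡ k ℤ.* w j) → ℤ.∣ k ∣ ≡ 1

-- ℝ₊ v, a subset of ℝⁿ; rays are compared as subsets, by _≐_.
ray : ∀ {n} → ℤ^ n → Pred (ℝ^ n) 0ℓ
ray v x = ∃[ t ] (0≤ℝ t × (∀ j → x j ≃ t *ℤ v j))

record TropicalFan₁ (n : ℕ) : Set where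
  field
    q           : ℕ
    v           : Fin q → ℤ^ n
    ω           : Fin q → ℤ
    isPrimitive : ∀ i → Primitive (v i)
    distinct    : Injective _≡_ _≐_ (ray ∘ v)
    ω-positive  : ∀ i → 0ℤ ℤ.< ω i
    balanced    : ∀ j → sumℤ (λ i → ω i ℤ.* v i j) ≡ 0ℤ

RaysSpan : ∀ {n} → TropicalFan₁ n → Set
RaysSpan {n} F = ∀ (x : ℝ^ n) → Σ[ c ∈ Vector ℝ q ] (∀ j → x j ≃ sumℝ (λ i → c i *ℤ v i j))
  where open TropicalFan₁ F

infix 7 _·_

_·_ : ∀ {n} → (ℤ^ n → ℤ) → TropicalFan₁ n → ℤ
L · F = sumℤ (λ i → ω i ℤ.* L (v i))
  where open TropicalFan₁ F

-- Meant for L · F ≡ 1ℤ only.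
gallery : ∀ {n} → TropicalFan₁ n → (ℤ^ n → ℤ) → Pred (Pred (ℝ^ n) 0ℓ) 0ℓ
gallery F L R = ∃[ i ] (R ≐ ray (v i) × L (v i) ℤ.+ L (-ᵛ v i) ≡ 1ℤ)
  where open TropicalFan₁ F

｛_,_｝₂ : ∀ {n} → Pred (ℝ^ n) 0ℓ → Pred (ℝ^ n) 0ℓ → Pred (Pred (ℝ^ n) 0ℓ) 0ℓ
｛ R , S ｝₂ T = T ≐ R ⊎ T ≐ S

{-# OPTIONS --safe #-}
module Submission where

-- A sum of nonnegative integers equals 1 only if one term is 1 and all others
-- vanish.  This applies to L · F = Σ ωᵢ max(0, l(vᵢ)), which produces a.  Since
-- max(0,x) = x + max(0,-x) and Σ ωᵢ l(vᵢ) = l(Σ ωᵢ vᵢ) = 0 by balancing, it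
-- applies as well to Σ ωᵢ max(0, -l(vᵢ)), which produces b.

open import Defs
open import Algebra.Module.Morphism.Structures using (module LeftModuleMorphisms)
import Algebra.Properties.CommutativeMonoid.Sum as CommutativeMonoidSum
open import Data.Empty using (⊥-elim)
open import Data.Fin.Base using (Fin; zero; suc)
import Data.Fin.Properties as Fin
open import Data.Integer.Base using (ℤ; 0ℤ; 1ℤ; -1ℤ; +_; +0; +[1+_]; -[1+_]; +≤+; +<+; _+_; _*_; -_; _≤_; _<_; _⊔_; ∣_∣)
open import Data.Integer.Properties using (+-0-commutativeMonoid; +-mono-≤; +-identityˡ; +-inverseˡ; +-injective; *-distribˡ-+; *-zeroʳ; i*j≡0⇒i≡0∨j≡0; i≤i⊔j; i⊔j≡i⇒j≤i; neg-injective; neg-cancel-≤; ≤-antisym; ≤-refl; <⇒≤; <⇒≢; abs-*)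
open import Data.Nat.Base using (ℕ; z≤n)
import Data.Nat.Properties as ℕ
open import Data.Product.Base using (∃-syntax; _×_; _,_)
open import Data.Sum.Base as Sum using (_⊎_; inj₁; inj₂)
open import Data.Vec.Functional using (Vector)
open import Function.Base using (_∘_)
open import Relation.Binary.PropositionalEquality using (_≡_; _≢_; refl; sym; trans; cong; cong₂; subst; module ≡-Reasoning)
open import Relation.Nullary.Decidable.Core using (yes; no)
open import Relation.Nullary.Negation.Core using (¬_)
open import Relation.Unary using (_≐_)

open CommutativeMonoidSum +-0-commutativeMonoid using (∑-distrib-+; sum-cong-≗)

i+j≡0⇒i≡0∧j≡0 : ∀ {i j} → 0ℤ ≤ i → 0ℤ ≤ j → i + j ≡ 0ℤ → i ≡ 0ℤ × j ≡ 0ℤ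
i+j≡0⇒i≡0∧j≡0 {+ m} (+≤+ _) (+≤+ _) eq =
  cong +_ (ℕ.m+n≡0⇒m≡0 m (+-injective eq)) , cong +_ (ℕ.m+n≡0⇒n≡0 m (+-injective eq))

i+j≡1⇒01∨10 : ∀ {i j} → 0ℤ ≤ i → 0ℤ ≤ j → i + j ≡ 1ℤ →
              (i ≡ 0ℤ × j ≡ 1ℤ) ⊎ (i ≡ 1ℤ × j ≡ 0ℤ)
i+j≡1⇒01∨10 {+0}       (+≤+ _) (+≤+ _) eq = inj₁ (refl , eq)
i+j≡1⇒01∨10 {+[1+ m ]} (+≤+ _) (+≤+ _) eq
  -- The first summand is `1 + m`, so cancelling the successor leaves two naturals with sum 0.
  with refl ← ℕ.m+n≡0⇒m≡0 m (ℕ.suc-injective (+-injective eq))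
     | refl ← ℕ.m+n≡0⇒n≡0 m (ℕ.suc-injective (+-injective eq)) = inj₂ (refl , refl)

i*j≡1⇒i≡1∧j≡1 : ∀ {i j} → 0ℤ ≤ i → 0ℤ ≤ j → i * j ≡ 1ℤ → i ≡ 1ℤ × j ≡ 1ℤ
i*j≡1⇒i≡1∧j≡1 {+ m} {+ n} (+≤+ _) (+≤+ _) eq =
  cong +_ (ℕ.m*n≡1⇒m≡1 m n mn≡1) , cong +_ (ℕ.m*n≡1⇒n≡1 m n mn≡1)
  where mn≡1 = trans (sym (abs-* (+ m) (+ n))) (cong ∣_∣ eq)

0≤i*j : ∀ {i j} → 0ℤ < i → 0ℤ ≤ j → 0ℤ ≤ i * j
0≤i*j {+[1+ m ]} {+0}       _ _ = subst (0ℤ ≤_) (sym (*-zeroʳ +[1+ m ])) ≤-refl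
0≤i*j {+[1+ m ]} {+[1+ n ]} _ _ = +≤+ z≤n
0≤i*j {+0}       (+<+ ())

0⊔i≡1⇒i≡1 : ∀ i → 0ℤ ⊔ i ≡ 1ℤ → i ≡ 1ℤ
-- For negative `i` the maximum reduces to `0ℤ`, which cannot equal `1ℤ`; for the others it reduces
-- to `i`.
0⊔i≡1⇒i≡1 (+ _) eq = eq

-- An integer is its positive part minus its negative part; the additive form lets weighted sums
-- split by distributivity.
0⊔i≡i+0⊔-i : ∀ i → 0ℤ ⊔ i ≡ i + (0ℤ ⊔ - i)
0⊔i≡i+0⊔-i +0       = refl
0⊔i≡i+0⊔-i +[1+ n ] = cong +[1+_] (sym (ℕ.+-identityʳ n))
0⊔i≡i+0⊔-i -[1+ n ] = sym (+-inverseˡ +[1+ n ])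

0≤sum : ∀ {q} (f : Vector ℤ q) → (∀ i → 0ℤ ≤ f i) → 0ℤ ≤ sumℤ f
0≤sum {ℕ.zero}  f 0≤f = ≤-refl
0≤sum {ℕ.suc q} f 0≤f = +-mono-≤ (0≤f zero) (0≤sum (f ∘ suc) (0≤f ∘ suc))

sum≡0⇒≡0 : ∀ {q} (f : Vector ℤ q) → (∀ i → 0ℤ ≤ f i) → sumℤ f ≡ 0ℤ → ∀ i → f i ≡ 0ℤ
sum≡0⇒≡0 {ℕ.suc _} f 0≤f eq i
  with i+j≡0⇒i≡0∧j≡0 (0≤f zero) (0≤sum (f ∘ suc) (0≤f ∘ suc)) eq
sum≡0⇒≡0 {ℕ.suc _} f 0≤f eq zero    | f₀≡0 , _   = f₀≡0
sum≡0⇒≡0 {ℕ.suc _} f 0≤f eq (suc i) | _ , rest≡0 = sum≡0⇒≡0 (f ∘ suc) (0≤f ∘ suc) rest≡0 i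

-- Induction on `q`: the head and the tail sum are nonnegative integers adding up to 1. If the head
-- is 1, the tail sum is 0 and all its terms vanish; if the head is 0, the unit term lies in the
-- tail.
sum≡1⇒unit : ∀ {q} (f : Vector ℤ q) → (∀ i → 0ℤ ≤ f i) → sumℤ f ≡ 1ℤ →
             ∃[ a ] (f a ≡ 1ℤ × (∀ i → i ≢ a → f i ≡ 0ℤ))
sum≡1⇒unit {ℕ.suc q} f 0≤f eq
  with i+j≡1⇒01∨10 (0≤f zero) (0≤sum (f ∘ suc) (0≤f ∘ suc)) eq
... | inj₂ (f₀≡1 , rest≡0) = zero , f₀≡1 , λ where
  zero    0≢0 → ⊥-elim (0≢0 refl)
  (suc i) _   → sum≡0⇒≡0 (f ∘ suc) (0≤f ∘ suc) rest≡0 i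
... | inj₁ (f₀≡0 , rest≡1)
  with a , fa≡1 , others ← sum≡1⇒unit (f ∘ suc) (0≤f ∘ suc) rest≡1 =
  suc a , fa≡1 , λ where
    zero    _   → f₀≡0
    (suc i) i≢a → others i (i≢a ∘ cong suc)

-- Integrality forces both factors of the unit term to be 1. A vanishing term has positive weight,
-- so its positive part is 0, which bounds `x i` only from above. Leaving `x` arbitrary allows both
-- l(vᵢ) and -l(vᵢ).
sum-positive-parts≡1⇒unit : ∀ {q} (w x : Vector ℤ q) → (∀ i → 0ℤ < w i) →
  sumℤ (λ i → w i * (0ℤ ⊔ x i)) ≡ 1ℤ →
  ∃[ a ] (w a ≡ 1ℤ × x a ≡ 1ℤ × (∀ i → i ≢ a → x i ≤ 0ℤ))
sum-positive-parts≡1⇒unit w x 0<w eq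
  with a , wa*xa≡1 , others ← sum≡1⇒unit _ (λ i → 0≤i*j (0<w i) (i≤i⊔j 0ℤ (x i))) eq
  with wa≡1 , 0⊔xa≡1 ← i*j≡1⇒i≡1∧j≡1 (<⇒≤ (0<w a)) (i≤i⊔j 0ℤ (x a)) wa*xa≡1
  = a , wa≡1 , 0⊔i≡1⇒i≡1 (x a) 0⊔xa≡1 , nonPositive
  where
  nonPositive : ∀ i → i ≢ a → x i ≤ 0ℤ
  nonPositive i i≢a with i*j≡0⇒i≡0∨j≡0 (w i) (others i i≢a)
  ... | inj₁ wi≡0   = ⊥-elim (<⇒≢ (0<w i) (sym wi≡0))
  ... | inj₂ 0⊔xi≡0 = i⊔j≡i⇒j≤i 0⊔xi≡0

-- The two sums differ by Σ wᵢ xᵢ, which is zero.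
sum-positive-parts≡sum-negative-parts : ∀ {q} (w x : Vector ℤ q) →
  sumℤ (λ i → w i * x i) ≡ 0ℤ →
  sumℤ (λ i → w i * (0ℤ ⊔ x i)) ≡ sumℤ (λ i → w i * (0ℤ ⊔ - x i))
sum-positive-parts≡sum-negative-parts w x eq = begin
  sumℤ (λ i → w i * (0ℤ ⊔ x i))
    ≡⟨ sum-cong-≗ (λ i → trans (cong (w i *_) (0⊔i≡i+0⊔-i (x i)))
                               (*-distribˡ-+ (w i) (x i) (0ℤ ⊔ - x i))) ⟩
  sumℤ (λ i → w i * x i + w i * (0ℤ ⊔ - x i))
    ≡⟨ ∑-distrib-+ (λ i → w i * x i) (λ i → w i * (0ℤ ⊔ - x i)) ⟩
  sumℤ (λ i → w i * x i) + sumℤ (λ i → w i * (0ℤ ⊔ - x i))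
    ≡⟨ cong (_+ sumℤ (λ i → w i * (0ℤ ⊔ - x i))) eq ⟩
  0ℤ + sumℤ (λ i → w i * (0ℤ ⊔ - x i))
    ≡⟨ +-identityˡ _ ⟩
  sumℤ (λ i → w i * (0ℤ ⊔ - x i)) ∎
  where open ≡-Reasoning

module _ {n} (l : Dual n) where
  open LeftModuleMorphisms.IsLeftModuleHomomorphism (isLinear l)

  linear-combination : ∀ {q} (w : Vector ℤ q) (v : Fin q → ℤ^ n) →
    ⟦ l ⟧ (λ j → sumℤ (λ i → w i * v i j)) ≡ sumℤ (λ i → w i * ⟦ l ⟧ (v i))
  linear-combination {ℕ.zero}  w v = 0ᴹ-homo
  linear-combination {ℕ.suc q} w v = trans (+ᴹ-homo _ _)
    (cong₂ _+_ (*ₗ-homo (w zero) (v zero)) (linear-combination (w ∘ suc) (v ∘ suc)))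

  max0-neg : ∀ x → max0 l (-ᵛ x) ≡ 0ℤ ⊔ - ⟦ l ⟧ x
  max0-neg x = cong (0ℤ ⊔_) (-ᴹ-homo x)

module _ {n} (F : TropicalFan₁ n) (l : Dual n) where
  open TropicalFan₁ F
  open LeftModuleMorphisms.IsLeftModuleHomomorphism (isLinear l)

  balanced⇒sum≡0 : sumℤ (λ i → ω i * ⟦ l ⟧ (v i)) ≡ 0ℤ
  -- `balanced` holds coordinate by coordinate, which is the equality on `ℤ^ n` that `⟦⟧-cong`
  -- expects.
  balanced⇒sum≡0 = trans (sym (linear-combination l ω v)) (trans (⟦⟧-cong balanced) 0ᴹ-homo)

  positive-ray : max0 l · F ≡ 1ℤ →
    ∃[ a ] (ω a ≡ 1ℤ × ⟦ l ⟧ (v a) ≡ 1ℤ × (∀ i → i ≢ a → ⟦ l ⟧ (v i) ≤ 0ℤ))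
  positive-ray = sum-positive-parts≡1⇒unit ω (⟦ l ⟧ ∘ v) ω-positive

  negative-ray : max0 l · F ≡ 1ℤ →
    ∃[ b ] (ω b ≡ 1ℤ × - ⟦ l ⟧ (v b) ≡ 1ℤ × (∀ i → i ≢ b → - ⟦ l ⟧ (v i) ≤ 0ℤ))
  negative-ray L·F≡1 = sum-positive-parts≡1⇒unit ω (-_ ∘ ⟦ l ⟧ ∘ v) ω-positive
    (trans (sym (sum-positive-parts≡sum-negative-parts ω (⟦ l ⟧ ∘ v) balanced⇒sum≡0)) L·F≡1)

  -- This number is |l(vᵢ)|. With the value of l named `k`, the right side evaluates to 1 at `1ℤ`
  -- and `-1ℤ` and to 0 at `0ℤ`, which decides membership in the gallery.
  width : ∀ i {k} → ⟦ l ⟧ (v i) ≡ k →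
    max0 l (v i) + max0 l (-ᵛ v i) ≡ (0ℤ ⊔ k) + (0ℤ ⊔ - k)
  width i refl = cong (_+_ (max0 l (v i))) (max0-neg l (v i))

  opposite⇒≢ : ∀ {a b} → ⟦ l ⟧ (v a) ≡ 1ℤ → ⟦ l ⟧ (v b) ≡ -1ℤ → a ≢ b
  opposite⇒≢ la≡1 lb≡-1 refl with () ← trans (sym la≡1) lb≡-1

  module _ {a b} (la≡1 : ⟦ l ⟧ (v a) ≡ 1ℤ) (lb≡-1 : ⟦ l ⟧ (v b) ≡ -1ℤ)
           (others : ∀ i → i ≢ a → i ≢ b → ⟦ l ⟧ (v i) ≡ 0ℤ) where

    width≡1⇒a∨b : ∀ i → max0 l (v i) + max0 l (-ᵛ v i) ≡ 1ℤ → i ≡ a ⊎ i ≡ b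
    width≡1⇒a∨b i width≡1 with i Fin.≟ a | i Fin.≟ b
    ... | yes i≡a | _       = inj₁ i≡a
    ... | no _    | yes i≡b = inj₂ i≡b
    ... | no i≢a  | no i≢b
      -- Off `a` and `b` the width evaluates to 0, so it cannot be 1.
      with () ← trans (sym width≡1) (width i (others i i≢a i≢b))

    gallery≐pair : gallery F (max0 l) ≐ ｛ ray (v a) , ray (v b) ｝₂
    gallery≐pair = to , from
      where
      to : ∀ {R} → gallery F (max0 l) R → ｛ ray (v a) , ray (v b) ｝₂ R
      to {R} (i , R≐rayᵢ , width≡1) = Sum.map along along (width≡1⇒a∨b i width≡1)
        where
        along : ∀ {k} → i ≡ k → R ≐ ray (v k)
        along i≡k = subst (λ k → R ≐ ray (v k)) i≡k R≐rayᵢ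

      from : ∀ {R} → ｛ ray (v a) , ray (v b) ｝₂ R → gallery F (max0 l) R
      from (inj₁ R≐rayₐ) = a , R≐rayₐ , width a la≡1
      from (inj₂ R≐rayᵦ) = b , R≐rayᵦ , width b lb≡-1

lemma3p3 : ∀ (n : ℕ) (F : TropicalFan₁ n) → RaysSpan F →
    ∀ (l : Dual n) → max0 l · F ≡ 1ℤ →
    let open TropicalFan₁ F in
    ∃[ a ] ∃[ b ]
    ( gallery F (max0 l) ≐ ｛ ray (v a) , ray (v b) ｝₂
    × ¬ (ray (v a) ≐ ray (v b))
    × ⟦ l ⟧ (v a) ≡ 1ℤ
    × ⟦ l ⟧ (v b) ≡ -1ℤ
    × ω a ≡ 1ℤ
    × ω b ≡ 1ℤ
    × (∀ i → i ≢ a → i ≢ b → ⟦ l ⟧ (v i) ≡ 0ℤ)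
    )
lemma3p3 n F _ l L·F≡1 =
  let open TropicalFan₁ F
      a , ωa≡1 , la≡1  , l≤0  = positive-ray F l L·F≡1
      b , ωb≡1 , -lb≡1 , -l≤0 = negative-ray F l L·F≡1
      lb≡-1 = neg-injective -lb≡1
      others : ∀ i → i ≢ a → i ≢ b → ⟦ l ⟧ (v i) ≡ 0ℤ
      -- Away from `a` the value of l is at most 0, and away from `b` at least 0; `0ℤ` is read as
      -- `- 0ℤ` to cancel the sign.
      others i i≢a i≢b = ≤-antisym (l≤0 i i≢a) (neg-cancel-≤ (-l≤0 i i≢b))
  -- Equal rays would give `a ≡ b` by `distinct`, yet l takes the values 1 and -1 there.
  in a , b , gallery≐pair F l la≡1 lb≡-1 others , opposite⇒≢ F l la≡1 lb≡-1 ∘ distinct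
     , la≡1 , lb≡-1 , ωa≡1 , ωb≡1 , others
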